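{- There is an algorithm that takes as input an $AE_L$ problem, i.e. a game $G=(S_1,S_2,E,w)$, an initial state $s_{\mathrm{init}}\in S$ and a threshold $t\in\mathbb{Q}$ (asking whether player 1 has a winning strategy from $s_{\mathrm{init}}$ for $\mathsf{Energy}_{L}(0)\cap\mathsf{AvgEnergy}(t)$), and iteratively solves the corresponding $AE_{LU}$ problems (asking whether player 1 has a winning strategy from $s_{\mathrm{init}}$ for $\mathsf{Energy}_{LU}(U,0)\cap\mathsf{AvgEnergy}(t)$) for incremental values of $U\in\mathbb{N}$, such that the following holds. If a winning strategy is found for some $U\in\mathbb{N}$, then it is also winning for the original $AE_L$ problem. If no strategy is found up to value $U\in\mathbb{N}$, then no strategy of player 1 can simultaneously win the $AE_L$ problem and prevent the energy level from exceeding $U$ at all times.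
   Context: A game is a tuple $G=(S_1,S_2,E,w)$ where $S_1,S_2$ are disjoint finite sets of states belonging to player 1 and player 2, $S=S_1\uplus S_2$, $E\subseteq S\times S$ is a finite set of edges such that every state has at least one outgoing edge, and $w\colon E\to\mathbb{Z}$ is an integer weight function. A play from $s_{\mathrm{init}}$ is an infinite sequence $\pi=s_0s_1s_2\dots$ with $s_0=s_{\mathrm{init}}$ and $(s_i,s_{i+1})\in E$ for all $i\ge 0$; $\pi(n)=s_0\dots s_n$ is its prefix up to position $n$. A strategy for player $i$ is a function mapping each finite prefix ending in a state of $S_i$ to a successor (along an edge) of its last state. Strategies of the two players and $s_{\mathrm{init}}$ determine a unique play, the outcome. The energy level is $\mathrm{EL}(\pi(n))=\sum_{i=0}^{n-1}w(s_i,s_{i+1})$, and the average-energy of $\pi$ is $\overline{AE}(\pi)=\limsup_{n\to\infty}\frac1n\sum_{i=1}^{n}\mathrm{EL}(\pi(i))$. $\mathsf{AvgEnergy}(t)$ is the set of plays $\pi$ with $\overline{AE}(\pi)\le t$. For $U,c\in\mathbb{N}$, $\mathsf{Energy}_{L}(c)$ is the set of plays $\pi$ with $c+\mathrm{EL}(\pi(n))\ge 0$ for all $n\ge 0$, and $\mathsf{Energy}_{LU}(U,c)$ is the set of plays $\pi$ with $c+\mathrm{EL}(\pi(n))\in[0,U]$ for all $n\ge 0$. A strategy of player 1 is winning from $s_{\mathrm{init}}$ for an objective $\mathcal W$ (a set of plays) if, for every strategy of player 2, the outcome lies in $\mathcal W$. The algorithm is not required to terminate. -}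

module Defs where

open import Data.Bool.Base using (Bool; T)
open import Data.Fin.Base using (Fin)
open import Data.Integer.Base as ℤ using (ℤ; +_; 0ℤ)
open import Data.Maybe.Base using (Maybe; just; nothing; _<∣>_)
open import Data.Nat.Base as ℕ using (ℕ; zero; suc; NonZero)
open import Data.Product.Base using (∃; ∃-syntax; _×_; _,_; proj₁; proj₂)
open import Data.Rational.Base as ℚ using (ℚ; 0ℚ)
open import Data.Sum.Base using (_⊎_; inj₁; inj₂)
open import Level using (0ℓ)
open import Relation.Nullary.Decidable.Core using (Dec; yes; no)
open import Relation.Unary using (Pred; _∩_)

-- The edge set is given by its Boolean characteristic function, so that a pair
-- of states carries at most one edge and the weight depends on the pair alone.
record Game : Set where
  field
    n₁ n₂ : ℕ

  S₁ : Set
  S₁ = Fin n₁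

  S₂ : Set
  S₂ = Fin n₂

  S : Set
  S = S₁ ⊎ S₂

  field
    edge? : S → S → Bool

  E : S → S → Set
  E s s′ = T (edge? s s′)

  field
    total : ∀ s → ∃[ s′ ] E s s′
    w     : ∀ {s s′} → E s s′ → ℤ

module Plays (G : Game) where
  open Game G

  record Play : Set where
    field
      state : ℕ → S
      step  : ∀ i → E (state i) (state (suc i))

  open Play public

  -- Nonempty finite paths, indexed by their last state.
  infixl 5 _▷_
  data Prefix : S → Set where
    start : ∀ s → Prefix s
    _▷_   : ∀ {s s′} → Prefix s → E s s′ → Prefix s′

  prefix : (π : Play) (n : ℕ) → Prefix (state π n)
  prefix π zero    = start (state π 0)
  prefix π (suc n) = prefix π n ▷ step π n

  Strategy₁ : Set
  Strategy₁ = (s : S₁) → Prefix (inj₁ s) → ∃[ s′ ] E (inj₁ s) s′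

  Strategy₂ : Set
  Strategy₂ = (s : S₂) → Prefix (inj₂ s) → ∃[ s′ ] E (inj₂ s) s′

  move : Strategy₁ → Strategy₂ → ∀ {s} → Prefix s → ∃[ s′ ] E s s′
  move σ τ {inj₁ s} ρ = σ s ρ
  move σ τ {inj₂ s} ρ = τ s ρ

  history : Strategy₁ → Strategy₂ → S → ℕ → ∃ Prefix
  history σ τ s zero    = s , start s
  history σ τ s (suc n) = let (_ , ρ) = history σ τ s n in
                          _ , ρ ▷ proj₂ (move σ τ ρ)

  outcome : Strategy₁ → Strategy₂ → S → Play
  outcome σ τ s = record
    { state = λ n → proj₁ (history σ τ s n)
    ; step  = λ n → proj₂ (move σ τ (proj₂ (history σ τ s n)))
    }

  Objective : Set₁
  Objective = Pred Play 0ℓ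

  Winning : S → Objective → Pred Strategy₁ 0ℓ
  Winning s W σ = ∀ (τ : Strategy₂) → W (outcome σ τ s)

-- sum₁ f n = f 1 + … + f n
sum₁ : (ℕ → ℤ) → ℕ → ℤ
sum₁ f zero    = 0ℤ
sum₁ f (suc n) = sum₁ f n ℤ.+ f (suc n)

-- sup_{n ≥ N} aₙ ≤ r
SupFrom≤ : (ℕ → ℚ) → ℕ → ℚ → Set
SupFrom≤ a N r = ∀ n → N ℕ.≤ n → a n ℚ.≤ r

-- lim supₙ aₙ = inf_N sup_{n ≥ N} aₙ ≤ r, the limit superior being an extended
-- real: an infimum is at most r iff members of the family are at most r + ε
-- for every ε > 0.
LimSup≤ : (ℕ → ℚ) → ℚ → Set
LimSup≤ a r = ∀ ε → 0ℚ ℚ.< ε → ∃[ N ] SupFrom≤ a N (r ℚ.+ ε)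

module Objectives (G : Game) where
  open Game G
  open Plays G

  EL : ∀ {s} → Prefix s → ℤ
  EL (start _) = 0ℤ
  EL (ρ ▷ e)   = EL ρ ℤ.+ w e

  average : Play → (n : ℕ) .{{_ : NonZero n}} → ℚ
  average π n = sum₁ (λ i → EL (prefix π i)) n ℚ./ n

  -- The averages are defined for n ≥ 1, hence the shift.
  AvgEnergy : ℚ → Objective
  AvgEnergy t π = LimSup≤ (λ n → average π (suc n)) t

  EnergyL : ℕ → Objective
  EnergyL c π = ∀ n → 0ℤ ℤ.≤ + c ℤ.+ EL (prefix π n)

  EnergyLU : ℕ → ℕ → Objective
  EnergyLU U c π = ∀ n → 0ℤ ℤ.≤ + c ℤ.+ EL (prefix π n)
                       × + c ℤ.+ EL (prefix π n) ℤ.≤ + U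

  NeverExceeds : ℕ → Objective
  NeverExceeds U π = ∀ n → EL (prefix π n) ℤ.≤ + U

record Problem : Set where
  field
    G     : Game
    sInit : Game.S G
    t     : ℚ

  open Plays G public
  open Objectives G public

  WinsAEL : Pred Strategy₁ 0ℓ
  WinsAEL = Winning sInit (EnergyL 0 ∩ AvgEnergy t)

  WinsAELU : ℕ → Pred Strategy₁ 0ℓ
  WinsAELU U = Winning sInit (EnergyLU U 0 ∩ AvgEnergy t)

-- A procedure that decides every AE_LU problem and, on a positive answer,
-- returns a winning strategy.
AELUSolver : Set
AELUSolver = (P : Problem) (U : ℕ) → let open Problem P in Dec (∃ (WinsAELU U))

module Incremental (solve : AELUSolver) (P : Problem) where
  open Problem P

  round : ℕ → Maybe (ℕ × Strategy₁)
  round U with solve P U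
  ... | yes (σ , _) = just (U , σ)
  ... | no _        = nothing

  -- The state of the unbounded loop U = 0, 1, 2, … after round U: the first
  -- strategy found, together with its bound, or nothing if the search goes on.
  search : ℕ → Maybe (ℕ × Strategy₁)
  search zero    = round zero
  search (suc U) = search U <∣> round (suc U)

-- Every AE_LU problem is a finite game on configurations (state, energy level): player 1
-- must keep the level in [0, U] and the mean payoff, with payoff q·level − p for t = p/q,
-- at most 0. Play it as a first-cycle game: it stops when a configuration repeats, and
-- player 1 wins iff the cycle closed has payoff ≤ 0. This game has bounded duration, so
-- backward induction decides it. Its winner wins the infinite game by keeping a stack of
-- the configurations visited, cutting out each cycle as it closes and going on from the
-- remaining simple path: up to a bounded error, the payoff of the play is the sum of
-- those of the cycles cut out, each ≤ 0 for player 1 and, payoffs being integers, each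
-- ≥ 1 for player 2. As cycles have bounded length, the average of the payoffs is
-- bounded away from 0 in the second case.

module Submission where

open import Defs
open import Algebra.Properties.AbelianGroup using (xyx⁻¹≈y)
open import Data.Bool.Properties using (T-irrelevant)
open import Data.Empty using (⊥)
open import Data.Fin.Base as Fin using (Fin; fromℕ<; combine; join)
import Data.Fin.Properties as Fin
open import Data.Integer.Base as ℤ using (ℤ; +_; 0ℤ; 1ℤ; ∣_∣; -_)
open import Data.Integer.Properties as ℤ using ()
open import Data.Integer.Tactic.RingSolver using (solve-∀)
open import Data.List.Base using (List; []; _∷_; _++_; length; lookup)
import Data.List.Membership.DecPropositional as DecMembership
open import Data.List.Membership.Propositional.Properties using (∈-∃++; ∈-lookup)
open import Data.List.Properties using (length-++)
open import Data.List.Relation.Unary.All as All using (All; []; _∷_)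
open import Data.List.Relation.Unary.All.Properties using (¬Any⇒All¬)
open import Data.List.Relation.Unary.AllPairs using (AllPairs; []; _∷_)
open import Data.List.Relation.Unary.Unique.Propositional using (Unique)
open import Data.Maybe.Base using (Maybe; just; nothing; maybe; _>>=_)
open import Data.Nat.Base as ℕ using (ℕ; zero; suc; s≤s; z≤n)
import Data.Nat.Properties as ℕ
open import Data.Product.Base using (Σ-syntax; ∃; _×_; _,_; proj₁; proj₂; uncurry)
open import Data.Product.Properties using (≡-dec)
open import Data.Rational.Base as ℚ using (ℚ; 0ℚ; ↥_; ↧_; ↧ₙ_)
import Data.Rational.Properties as ℚ
open import Data.Rational.Unnormalised.Base as ℚᵘ using (mkℚᵘ)
import Data.Rational.Unnormalised.Properties as ℚᵘ
open import Data.Sum.Base as Sum using (_⊎_; inj₁; inj₂)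
import Data.Sum.Properties as Sum
open import Data.Unit.Base using (⊤; tt)
open import Function.Base using (_∘_)
open import Relation.Binary.Definitions using (DecidableEquality)
open import Relation.Binary.PropositionalEquality
  using (_≡_; refl; sym; trans; cong; cong₂; subst)
open import Relation.Nullary.Decidable using (Dec; yes; no; T?; _×-dec_)
open import Relation.Nullary.Negation.Core using (¬_; contradiction)

-- Integer and rational inequalities, and limits superior of averages.

≤-from-difference : ∀ {i j k l} → i ℤ.≤ j → l ℤ.- k ≡ j ℤ.- i → k ℤ.≤ l
≤-from-difference i≤j eq =
  ℤ.0≤i-j⇒j≤i (subst (0ℤ ℤ.≤_) (sym eq) (ℤ.i≤j⇒0≤j-i i≤j))

i≤+∣i∣ : ∀ i → i ℤ.≤ + ∣ i ∣
i≤+∣i∣ (+ n)      = ℤ.≤-refl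
i≤+∣i∣ ℤ.-[1+ n ] = ℤ.-≤+

/-≤⁺ : ∀ i j {m n} → i ℤ.* + suc n ℤ.≤ j ℤ.* + suc m → i ℚ./ suc m ℚ.≤ j ℚ./ suc n
/-≤⁺ i j {m} {n} le = ℚ.toℚᵘ-cancel-≤
  (ℚᵘ.≤-respˡ-≃ (ℚᵘ.≃-sym (ℚ.toℚᵘ-fromℚᵘ (mkℚᵘ i m)))
  (ℚᵘ.≤-respʳ-≃ (ℚᵘ.≃-sym (ℚ.toℚᵘ-fromℚᵘ (mkℚᵘ j n))) (ℚᵘ.*≤* le)))

/-≤⁻ : ∀ i j {m n} → i ℚ./ suc m ℚ.≤ j ℚ./ suc n → i ℤ.* + suc n ℤ.≤ j ℤ.* + suc m
/-≤⁻ i j {m} {n} le = ℚᵘ.drop-*≤*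
  (ℚᵘ.≤-respˡ-≃ (ℚ.toℚᵘ-fromℚᵘ (mkℚᵘ i m))
  (ℚᵘ.≤-respʳ-≃ (ℚ.toℚᵘ-fromℚᵘ (mkℚᵘ j n)) (ℚ.toℚᵘ-mono-≤ le)))

/-<⁺ : ∀ i j {m n} → i ℤ.* + suc n ℤ.< j ℤ.* + suc m → i ℚ./ suc m ℚ.< j ℚ./ suc n
/-<⁺ i j {m} {n} lt = ℚ.toℚᵘ-cancel-<
  (ℚᵘ.<-respˡ-≃ (ℚᵘ.≃-sym (ℚ.toℚᵘ-fromℚᵘ (mkℚᵘ i m)))
  (ℚᵘ.<-respʳ-≃ (ℚᵘ.≃-sym (ℚ.toℚᵘ-fromℚᵘ (mkℚᵘ j n))) (ℚᵘ.*<* lt)))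

p+[q-p]≡q : ∀ p q → p ℚ.+ (q ℚ.- p) ≡ q
p+[q-p]≡q p q = trans (sym (ℚ.+-assoc p q (ℚ.- p))) (xyx⁻¹≈y ℚ.+-0-abelianGroup p q)

p<q⇒0<q-p : ∀ {p q} → p ℚ.< q → 0ℚ ℚ.< q ℚ.- p
p<q⇒0<q-p {p} {q} p<q =
  subst (ℚ._< q ℚ.- p) (ℚ.+-inverseʳ p) (ℚ.+-monoˡ-< (ℚ.- p) p<q)

-- In integers, `t < r` is a gap of at least 1 between cross products. Multiplied by `suc n`, it
-- absorbs the excess `C` once `n` reaches `∣ C ∣` times the denominator of `r`.
limSup≤⁺ : ∀ (a : ℕ → ℤ) t C → (∀ n → ↧ t ℤ.* a (suc n) ℤ.+ - ↥ t ℤ.* + suc n ℤ.≤ C) →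
           LimSup≤ (λ n → a (suc n) ℚ./ suc n) t
limSup≤⁺ a t C bounded ε 0<ε = N , from-N
  where
  r = t ℚ.+ ε
  q = ↧ t
  p = ↥ t
  b = ↧ r
  N = ∣ C ∣ ℕ.* ↧ₙ r

  t<r : ℤ.suc (p ℤ.* b) ℤ.≤ ↥ r ℤ.* q
  t<r = ℤ.i<j⇒suc[i]≤j (ℚ.drop-*<*
    (subst (ℚ._< r) (ℚ.+-identityʳ t) (ℚ.+-monoʳ-< t 0<ε)))

  from-N : SupFrom≤ (λ n → a (suc n) ℚ./ suc n) N r
  from-N n N≤n = subst (a m ℚ./ m ℚ.≤_) (ℚ.↥p/↧p≡p r)
    (/-≤⁺ (a m) (↥ r) (ℤ.*-cancelˡ-≤-pos (a m ℤ.* b) (↥ r ℤ.* + m) q scaled))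
    where
    m = suc n
    Cb≤m : C ℤ.* b ℤ.≤ + m
    Cb≤m = ℤ.≤-trans (ℤ.*-monoʳ-≤-nonNeg b (i≤+∣i∣ C))
      (ℤ.≤-trans (ℤ.≤-reflexive (sym (ℤ.pos-* ∣ C ∣ (↧ₙ r))))
        (ℤ.+≤+ (ℕ.≤-trans N≤n (ℕ.n≤1+n n))))
    scaled : q ℤ.* (a m ℤ.* b) ℤ.≤ q ℤ.* (↥ r ℤ.* + m)
    -- The three inequalities are added; a ring identity matches the difference of their sides with
    -- that of the goal.
    scaled = ≤-from-difference
      (ℤ.+-mono-≤ (ℤ.*-monoʳ-≤-nonNeg b (bounded n))
        (ℤ.+-mono-≤ (ℤ.*-monoʳ-≤-nonNeg (+ m) t<r) Cb≤m))
      (identity q (a m) b (↥ r) (+ m) p C)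
      where
      identity : ∀ q s b r m p C →
        q ℤ.* (r ℤ.* m) ℤ.- q ℤ.* (s ℤ.* b) ≡
        (C ℤ.* b ℤ.+ (r ℤ.* q ℤ.* m ℤ.+ m)) ℤ.-
        ((q ℤ.* s ℤ.+ - p ℤ.* m) ℤ.* b ℤ.+ ((1ℤ ℤ.+ p ℤ.* b) ℤ.* m ℤ.+ C ℤ.* b))
      identity = solve-∀

limSup≤⁻ : ∀ (a : ℕ → ℤ) t M →
           LimSup≤ (λ n → a (suc n) ℚ./ suc n) t →
           Σ[ N ∈ ℕ ] (∀ n → N ℕ.≤ n →
             + suc M ℤ.* (↧ t ℤ.* a (suc n) ℤ.+ - ↥ t ℤ.* + suc n) ℤ.≤ + suc n)
limSup≤⁻ a t@(ℚ.mkℚ p q-1 _) M lim = proj₁ from , λ n N≤n →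
  let m = suc n
      average≤r = subst (a m ℚ./ m ℚ.≤_) (p+[q-p]≡q t r) (proj₂ from n N≤n)
  in ≤-from-difference (/-≤⁻ (a m) r-num average≤r)
       (trans (identity (+ suc M) q (a m) p (+ m))
         (cong (λ d → r-num ℤ.* + m ℤ.- a m ℤ.* d) (sym (ℤ.pos-* (suc M) (suc q-1)))))
  where
  q = + suc q-1
  -- `r` exceeds `t` by one over `suc M` times `q`, and this gap serves as ε.
  r-num = + suc M ℤ.* p ℤ.+ 1ℤ
  r = r-num ℚ./ (suc M ℕ.* suc q-1)

  t<r : t ℚ.< r
  t<r = subst (ℚ._< r) (ℚ.↥p/↧p≡p t) (/-<⁺ p r-num (ℤ.suc[i]≤j⇒i<j
    (≤-from-difference (ℤ.+≤+ (s≤s (z≤n {q-1})))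
      (trans
        (cong (λ d → r-num ℤ.* q ℤ.- (1ℤ ℤ.+ p ℤ.* d)) (ℤ.pos-* (suc M) (suc q-1)))
        (identity₁ (+ suc M) q p)))))
    where
    identity₁ : ∀ M q p →
      (M ℤ.* p ℤ.+ 1ℤ) ℤ.* q ℤ.- (1ℤ ℤ.+ p ℤ.* (M ℤ.* q)) ≡ q ℤ.- 1ℤ
    identity₁ = solve-∀

  from : Σ[ N ∈ ℕ ] SupFrom≤ (λ n → a (suc n) ℚ./ suc n) N (t ℚ.+ (r ℚ.- t))
  from = lim (r ℚ.- t) (p<q⇒0<q-p t<r)

  identity : ∀ M q s p m →
    m ℤ.- M ℤ.* (q ℤ.* s ℤ.+ - p ℤ.* m) ≡ (M ℤ.* p ℤ.+ 1ℤ) ℤ.* m ℤ.- s ℤ.* (M ℤ.* q)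
  identity = solve-∀

-- A prefix of `n` steps has `n + 1` configurations, while the average divides by `n`. The mismatch
-- costs only the constant `↥ t`.
bounded⇒limSup≤ : ∀ (a : ℕ → ℤ) t C → (∀ n → ↧ t ℤ.* a n ℤ.+ - ↥ t ℤ.* + suc n ℤ.≤ C) →
                  LimSup≤ (λ n → a (suc n) ℚ./ suc n) t
bounded⇒limSup≤ a t C bounded = limSup≤⁺ a t (C ℤ.+ ↥ t) λ n →
  ≤-from-difference (bounded (suc n)) (identity (↧ t) (↥ t) (a (suc n)) (+ suc n) C)
  where
  identity : ∀ q p s m C → (C ℤ.+ p) ℤ.- (q ℤ.* s ℤ.+ - p ℤ.* m) ≡
             C ℤ.- (q ℤ.* s ℤ.+ - p ℤ.* (1ℤ ℤ.+ m))
  identity = solve-∀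

-- The hypothesis makes `K` times the excess over `t` grow at least like `2n`, whereas a limit
-- superior of at most `t` lets it grow at most like `n`.
bounded⇒¬limSup≤ : ∀ (a : ℕ → ℤ) t M C → let K = + suc M in
  (∀ n → - (K ℤ.* ↧ t) ℤ.* a n ℤ.+ (+ 2 ℤ.+ K ℤ.* ↥ t) ℤ.* + suc n ℤ.≤ C) →
  ¬ LimSup≤ (λ n → a (suc n) ℚ./ suc n) t
bounded⇒¬limSup≤ a t M C bounded lim = absurd (limSup≤⁻ a t M lim)
  where
  K = + suc M
  -- Adding both bounds leaves `suc n ≤ D`, which fails for `n = N + ∣ D ∣`.
  D = C ℤ.- K ℤ.* ↥ t ℤ.- + 2

  identity : ∀ K q p s m C →
    (C ℤ.- K ℤ.* p ℤ.- + 2) ℤ.- m ≡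
    (m ℤ.+ C) ℤ.- (K ℤ.* (q ℤ.* s ℤ.+ - p ℤ.* m) ℤ.+
      (- (K ℤ.* q) ℤ.* s ℤ.+ (+ 2 ℤ.+ K ℤ.* p) ℤ.* (1ℤ ℤ.+ m)))
  identity = solve-∀

  absurd : ¬ (Σ[ N ∈ ℕ ] (∀ n → N ℕ.≤ n →
             K ℤ.* (↧ t ℤ.* a (suc n) ℤ.+ - ↥ t ℤ.* + suc n) ℤ.≤ + suc n))
  absurd (N , eventually) = ℕ.<⇒≱ (s≤s (ℕ.m≤n+m ∣ D ∣ N)) (ℤ.drop‿+≤+ (ℤ.≤-trans n<D (i≤+∣i∣ D)))
    where
    n = N ℕ.+ ∣ D ∣
    n<D : + suc n ℤ.≤ D
    n<D = ≤-from-difference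
      (ℤ.+-mono-≤ (eventually n (ℕ.m≤m+n N ∣ D ∣)) (bounded (suc n)))
      (identity K (↧ t) (↥ t) (a (suc n)) (+ suc n) C)

-- Finite sets: pigeonhole and exhaustive choice.

AllPairs-lookup : ∀ {A : Set} {R : A → A → Set} {xs} → AllPairs R xs →
                  ∀ {i j} → i Fin.< j → R (lookup xs i) (lookup xs j)
AllPairs-lookup (r ∷ _)  {Fin.zero}  {Fin.suc j} _         = All.lookup r (∈-lookup j)
AllPairs-lookup (_ ∷ rs) {Fin.suc i} {Fin.suc j} (s≤s i<j) = AllPairs-lookup rs i<j

Unique⇒length≤ : ∀ {A : Set} {P : A → Set} {n} (f : ∀ x → P x → Fin n) →
                 (∀ {x y} (px : P x) (py : P y) → f x px ≡ f y py → x ≡ y) →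
                 ∀ {xs} → Unique xs → All P xs → length xs ℕ.≤ n
Unique⇒length≤ f f-injective {xs} unique pxs = ℕ.≮⇒≥ λ n<length →
  let i , j , i<j , eq = Fin.pigeonhole n<length λ i → f (lookup xs i) (p i)
  in AllPairs-lookup unique i<j (f-injective (p i) (p j) eq)
  where p = λ i → All.lookup pxs (∈-lookup i)

-- Feeds the backward induction: with `P` a win for one player and `Q` a win for the other, both
-- alternatives carry a strategy instead of a negation.
∃⊎∀-Fin : ∀ n {P Q : Fin n → Set} → (∀ i → P i ⊎ Q i) → ∃ P ⊎ (∀ i → Q i)
∃⊎∀-Fin zero    d = inj₂ λ ()
∃⊎∀-Fin (suc n) d with d Fin.zero | ∃⊎∀-Fin n (d ∘ Fin.suc)
... | inj₁ p | _            = inj₁ (Fin.zero , p)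
... | inj₂ _ | inj₁ (i , p) = inj₁ (Fin.suc i , p)
... | inj₂ q | inj₂ qs      = inj₂ λ { Fin.zero → q ; (Fin.suc i) → qs i }

-- Configurations and their enumeration.

module Arena (G : Game) (U : ℕ) where
  open Game G
  open Plays G
  open Objectives G

  Move : S → Set
  Move s = ∃ (E s)

  Config : Set
  Config = S × ℤ

  next : ∀ {s} → ℤ → Move s → Config
  next c (s′ , e) = s′ , c ℤ.+ w e

  config : ∀ {s} → Prefix s → Config
  config {s} ρ = s , EL ρ

  trace : ∀ {s} → Prefix s → List Config
  trace ρ@(start _) = config ρ ∷ []
  trace ρ@(ρ′ ▷ _)  = config ρ ∷ trace ρ′

  Valid : Config → Set
  Valid (_ , c) = 0ℤ ℤ.≤ c × c ℤ.≤ + U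

  valid? : ∀ v → Dec (Valid v)
  valid? (_ , c) = (0ℤ ℤ.≤? c) ×-dec (c ℤ.≤? + U)

  _≟ˢ_ : DecidableEquality S
  _≟ˢ_ = Sum.≡-dec Fin._≟_ Fin._≟_

  _≟ᶜ_ : DecidableEquality Config
  _≟ᶜ_ = ≡-dec _≟ˢ_ ℤ._≟_

  _≟ᵐ_ : ∀ {s} → DecidableEquality (Move s)
  _≟ᵐ_ = ≡-dec _≟ˢ_ λ e e′ → yes (T-irrelevant e e′)

  open DecMembership _≟ᶜ_ using (_∈?_)

  ∃⊎∀-Move : ∀ {s} {P Q : Move s → Set} → (∀ m → P m ⊎ Q m) → ∃ P ⊎ (∀ m → Q m)
  ∃⊎∀-Move {s} {P} {Q} d with ∃⊎∀-Fin n₁ (edge ∘ inj₁) | ∃⊎∀-Fin n₂ (edge ∘ inj₂)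
    where
    edge : ∀ s′ → (Σ[ e ∈ E s s′ ] P (s′ , e)) ⊎ (∀ e → Q (s′ , e))
    edge s′ with T? (edge? s s′)
    ... | no ¬e = inj₂ λ e → contradiction e ¬e
    -- Edge proofs are irrelevant, so judging one of them settles all.
    ... | yes e = Sum.map (e ,_)
      (λ q e′ → subst (λ e → Q (s′ , e)) (T-irrelevant e e′) q) (d (s′ , e))
  ... | inj₁ (i , e , p) | _                = inj₁ ((inj₁ i , e) , p)
  ... | inj₂ _           | inj₁ (i , e , p) = inj₁ ((inj₂ i , e) , p)
  ... | inj₂ qs          | inj₂ rs          = inj₂ λ { (inj₁ i , e) → qs i e ; (inj₂ i , e) → rs i e }

  size : ℕ
  size = (n₁ ℕ.+ n₂) ℕ.* suc U

  ∣c∣<suc[U] : ∀ {c} → 0ℤ ℤ.≤ c → c ℤ.≤ + U → ∣ c ∣ ℕ.< suc U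
  ∣c∣<suc[U] (ℤ.+≤+ _) (ℤ.+≤+ c≤U) = s≤s c≤U

  code : ∀ v → Valid v → Fin size
  code (s , c) (0≤c , c≤U) = combine (join n₁ n₂ s) (fromℕ< (∣c∣<suc[U] 0≤c c≤U))

  code-injective : ∀ {u v} (pu : Valid u) (pv : Valid v) → code u pu ≡ code v pv → u ≡ v
  code-injective {s , c} {s′ , c′} (0≤c , c≤U) (0≤c′ , c′≤U) eq
    with eqˢ , eqᶜ ← Fin.combine-injective (join n₁ n₂ s) _ (join n₁ n₂ s′) _ eq =
    cong₂ _,_
      (trans (sym (Fin.splitAt-join n₁ n₂ s))
        (trans (cong (Fin.splitAt n₁) eqˢ) (Fin.splitAt-join n₁ n₂ s′)))
      (trans (sym (ℤ.0≤i⇒+∣i∣≡i 0≤c))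
        (trans (cong +_ (Fin.fromℕ<-injective _ _
            (∣c∣<suc[U] 0≤c c≤U) (∣c∣<suc[U] 0≤c′ c′≤U) eqᶜ))
          (ℤ.0≤i⇒+∣i∣≡i 0≤c′)))

  levels : List Config → ℤ
  levels []             = 0ℤ
  levels ((_ , c) ∷ vs) = c ℤ.+ levels vs

  levels-++ : ∀ us vs → levels (us ++ vs) ≡ levels us ℤ.+ levels vs
  levels-++ []             vs = sym (ℤ.+-identityˡ (levels vs))
  levels-++ ((_ , c) ∷ us) vs =
    trans (cong (ℤ._+_ c) (levels-++ us vs)) (sym (ℤ.+-assoc c (levels us) (levels vs)))

  -- The start has level 0, so counting it in the trace leaves the sum from 1 to `n` unchanged.
  levels-trace : ∀ π n → levels (trace (prefix π n)) ≡ sum₁ (λ i → EL (prefix π i)) n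
  levels-trace π zero    = refl
  levels-trace π (suc n) =
    trans (cong (ℤ._+_ (EL (prefix π (suc n)))) (levels-trace π n)) (ℤ.+-comm (EL (prefix π (suc n))) _)

  length-trace : ∀ π n → length (trace (prefix π n)) ≡ suc n
  length-trace π zero    = refl
  length-trace π (suc n) = cong suc (length-trace π n)

  -- Linear payoffs of lists of configurations.

  module Weighted (α β : ℤ) where

    -- For `α = ↧ t` and `β = - ↥ t`, a nonempty list has load at most 0 exactly when its mean level
    -- is at most `t`.
    load : List Config → ℤ
    load vs = α ℤ.* levels vs ℤ.+ β ℤ.* + length vs

    load-++ : ∀ us vs → load (us ++ vs) ≡ load us ℤ.+ load vs
    load-++ us vs = trans
      (cong₂ (λ l n → α ℤ.* l ℤ.+ β ℤ.* n) (levels-++ us vs) (cong +_ (length-++ us)))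
      (identity α β (levels us) (levels vs) (+ length us) (+ length vs))
      where
      identity : ∀ α β l l′ n n′ → α ℤ.* (l ℤ.+ l′) ℤ.+ β ℤ.* (n ℤ.+ n′) ≡
                 (α ℤ.* l ℤ.+ β ℤ.* n) ℤ.+ (α ℤ.* l′ ℤ.+ β ℤ.* n′)
      identity = solve-∀

    ceiling : ℕ
    ceiling = ∣ α ∣ ℕ.* U ℕ.+ ∣ β ∣

    load≤ : ∀ {vs} → All Valid vs → load vs ℤ.≤ + (length vs ℕ.* ceiling)
    load≤ {[]} [] = ℤ.≤-reflexive (identity α β)
      where
      identity : ∀ α β → α ℤ.* 0ℤ ℤ.+ β ℤ.* 0ℤ ≡ 0ℤ
      identity = solve-∀
    load≤ {v@(s , c) ∷ vs} ((ℤ.+≤+ {n = n} _ , ℤ.+≤+ n≤U) ∷ valid) =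
      ℤ.≤-trans (ℤ.≤-reflexive (load-++ (v ∷ []) vs)) (ℤ.+-mono-≤ one (load≤ valid))
      where
      identity : ∀ α β n → α ℤ.* (n ℤ.+ 0ℤ) ℤ.+ β ℤ.* 1ℤ ≡ α ℤ.* n ℤ.+ β
      identity = solve-∀
      one : load (v ∷ []) ℤ.≤ + ceiling
      one = ℤ.≤-trans (ℤ.≤-reflexive (identity α β (+ n))) (ℤ.+-mono-≤
        (ℤ.≤-trans (i≤+∣i∣ (α ℤ.* + n)) (ℤ.+≤+ (ℕ.≤-trans (ℕ.≤-reflexive (ℤ.abs-* α (+ n)))
          (ℕ.*-monoʳ-≤ ∣ α ∣ n≤U))))
        (i≤+∣i∣ β))

    bound : ℤ
    bound = + (size ℕ.* ceiling)

    load≤bound : ∀ {vs} → Unique vs → All Valid vs → load vs ℤ.≤ bound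
    load≤bound unique valid = ℤ.≤-trans (load≤ valid)
      (ℤ.+≤+ (ℕ.*-monoˡ-≤ ceiling (Unique⇒length≤ code code-injective unique valid)))

  -- From a first-cycle win to a strategy, for either player.

  module Protagonist (Mine : S → Set) (Excused : Set) (α β : ℤ) where
    open Weighted α β public

    -- The list is the simple path left on the stack, latest configuration first.
    -- A play leaving the valid configurations is lost for the opponent if Excused holds.
    mutual
      data Win : List Config → Set where
        choose : ∀ {s c vs} → Mine s → (m : Move s) → After ((s , c) ∷ vs) (next c m) →
                 Win ((s , c) ∷ vs)
        reply  : ∀ {s c vs} → ((m : Move s) → After ((s , c) ∷ vs) (next c m)) →
                 Win ((s , c) ∷ vs)

      data After (vs : List Config) (v : Config) : Set where
        leave  : Excused → ¬ Valid v → After vs v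
        close  : Valid v → ∀ us us′ → vs ≡ us ++ v ∷ us′ → load (v ∷ us) ℤ.≤ 0ℤ → After vs v
        extend : Valid v → load (v ∷ vs) ℤ.≤ bound → Win (v ∷ vs) → After vs v

    -- Every nonempty suffix of the stack keeps its own winning node and load bound, since cutting
    -- out a cycle resumes the play from such a suffix.
    data Wins : List Config → Set where
      []  : Wins []
      _∷_ : ∀ {v vs} → load (v ∷ vs) ℤ.≤ bound × Win (v ∷ vs) → Wins vs → Wins (v ∷ vs)

    Wins-++⁻ʳ : ∀ us {vs} → Wins (us ++ vs) → Wins vs
    Wins-++⁻ʳ []       wins       = wins
    Wins-++⁻ʳ (_ ∷ us) (_ ∷ wins) = Wins-++⁻ʳ us wins

    -- rest is what remains of the play once every closed cycle has been cut out;
    -- the cycles removed all had load ≤ 0, hence repaid.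
    record Memory {s} (ρ : Prefix s) : Set where
      constructor memory
      field
        rest   : List Config
        wins   : Wins (config ρ ∷ rest)
        valid  : Valid (config ρ)
        repaid : load (trace ρ) ℤ.≤ load (config ρ ∷ rest)

      top : Win (config ρ ∷ rest)
      top with (_ , win) ∷ _ ← wins = win

      below-bound : load (trace ρ) ℤ.≤ bound
      below-bound with (le , _) ∷ _ ← wins = ℤ.≤-trans repaid le

    open Memory

    pick : ∀ {s c vs} → Win ((s , c) ∷ vs) → Move s
    pick {s} (choose _ m _) = m
    -- A `reply` node wins after every move, so any edge will do.
    pick {s} (reply _)      = total s

    repaid-∷ : ∀ {s s′} {ρ : Prefix s} (M : Memory ρ) (e : E s s′) →
               load (trace (ρ ▷ e)) ℤ.≤ load (config (ρ ▷ e) ∷ config ρ ∷ rest M)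
    repaid-∷ {ρ = ρ} M e = begin
      load (trace (ρ ▷ e))                         ≡⟨ load-++ (v ∷ []) (trace ρ) ⟩
      load (v ∷ []) ℤ.+ load (trace ρ)             ≤⟨ ℤ.+-monoʳ-≤ (load (v ∷ [])) (repaid M) ⟩
      load (v ∷ []) ℤ.+ load (config ρ ∷ rest M)   ≡⟨ load-++ (v ∷ []) (config ρ ∷ rest M) ⟨
      load (v ∷ config ρ ∷ rest M)                 ∎
      where
      open ℤ.≤-Reasoning
      v = config (ρ ▷ e)

    advance : ∀ {s s′} {ρ : Prefix s} (M : Memory ρ) (e : E s s′) →
              After (config ρ ∷ rest M) (config (ρ ▷ e)) → Maybe (Memory (ρ ▷ e))
    advance M e (leave _ _) = nothing
    advance {ρ = ρ} M e (close valid us us′ eq ≤0) =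
      just (memory us′ (Wins-++⁻ʳ us (subst Wins eq (wins M))) valid (begin
        load (trace (ρ ▷ e))                 ≤⟨ repaid-∷ M e ⟩
        load (v ∷ config ρ ∷ rest M)         ≡⟨ cong (load ∘ (v ∷_)) eq ⟩
        load (v ∷ us ++ v ∷ us′)             ≡⟨ load-++ (v ∷ us) (v ∷ us′) ⟩
        -- `v ∷ us` is the closed cycle; the older occurrence of `v` stays as the new top.
        load (v ∷ us) ℤ.+ load (v ∷ us′)     ≤⟨ ℤ.+-monoˡ-≤ (load (v ∷ us′)) ≤0 ⟩
        0ℤ ℤ.+ load (v ∷ us′)                ≡⟨ ℤ.+-identityˡ (load (v ∷ us′)) ⟩
        load (v ∷ us′)                       ∎))
      where
      open ℤ.≤-Reasoning
      v = config (ρ ▷ e)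
    advance M e (extend valid le win) =
      just (memory _ ((le , win) ∷ wins M) valid (repaid-∷ M e))

    follow : ∀ {s s′} {ρ : Prefix s} (M : Memory ρ) (e : E s s′) →
             Win (config ρ ∷ rest M) → Maybe (Memory (ρ ▷ e))
    follow M e (choose _ m after) with (_ , e) ≟ᵐ m
    ... | yes refl = advance M e after
    ... | no _     = nothing
    follow M e (reply after) = advance M e (after (_ , e))

    advance-just : ∀ {s s′} {ρ : Prefix s} (M : Memory ρ) (e : E s s′) after →
                   (Excused → Valid (config (ρ ▷ e))) → ∃ λ M′ → advance M e after ≡ just M′
    advance-just M e (leave excused ¬valid) valid = contradiction (valid excused) ¬valid
    advance-just M e (close _ _ _ _ _)      _     = _ , refl
    advance-just M e (extend _ _ _)         _     = _ , refl

    follow-just : ∀ {s s′} {ρ : Prefix s} (M : Memory ρ) (e : E s s′) win →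
                  (Mine s → (s′ , e) ≡ pick win) →
                  (Excused → Valid (config (ρ ▷ e))) → ∃ λ M′ → follow M e win ≡ just M′
    follow-just M e (choose mine m after) consistent valid with (_ , e) ≟ᵐ m
    ... | yes refl = advance-just M e after valid
    ... | no ≢m    = contradiction (consistent mine) ≢m
    follow-just M e (reply after) _ valid = advance-just M e (after (_ , e)) valid

    module FromRoot (s₀ : S) (win₀ : Win ((s₀ , 0ℤ) ∷ [])) (le₀ : load ((s₀ , 0ℤ) ∷ []) ℤ.≤ bound) where

      -- The result is nothing once the play has left the strategy or the valid configurations.
      track : ∀ {s} (ρ : Prefix s) → Maybe (Memory ρ)
      track (start s) with s ≟ˢ s₀
      ... | yes refl = just (memory [] ((le₀ , win₀) ∷ []) (ℤ.≤-refl , ℤ.+≤+ z≤n) ℤ.≤-refl)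
      ... | no _     = nothing
      track (ρ ▷ e) = track ρ >>= λ M → follow M e (top M)

      act : ∀ {s} → Prefix s → Move s
      -- Off the tracked prefixes the choice is arbitrary.
      act {s} ρ = maybe (pick ∘ top) (total s) (track ρ)

      module _ (π : Play) (from-root : state π 0 ≡ s₀)
               (consistent : ∀ n → Mine (state π n) → (state π (suc n) , step π n) ≡ act (prefix π n))
               (valid : Excused → ∀ n → Valid (config (prefix π n))) where

        tracked : ∀ n → ∃ λ M → track (prefix π n) ≡ just M
        tracked zero with state π 0 ≟ˢ s₀
        ... | yes refl = _ , refl
        ... | no ≢s₀   = contradiction from-root ≢s₀
        -- Abstracting `track` also turns the `act` in the type of `consistent n` into the move
        -- picked at the remembered node.
        tracked (suc n) with track (prefix π n) | tracked n | consistent n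
        ... | _ | M , refl | consistentₙ =
          follow-just M (step π n) (top M) consistentₙ (λ excused → valid excused (suc n))

        stays-valid : ∀ n → Valid (config (prefix π n))
        stays-valid n = Memory.valid (proj₁ (tracked n))

        stays-bounded : ∀ n → load (trace (prefix π n)) ℤ.≤ bound
        stays-bounded n = below-bound (proj₁ (tracked n))

  -- Determinacy of the first-cycle game.

  module Determinacy (q p : ℤ) where

    -- A cycle has at most size configurations. Subtracting K times an integer load ≥ 1
    -- outweighs the 2 charged per configuration, which makes the second player's
    -- load of any play grow linearly unless the average exceeds the threshold.
    penalty : ℕ
    penalty = 2 ℕ.* size

    K : ℤ
    K = + suc penalty

    module One = Protagonist (λ s → ∃ λ i → s ≡ inj₁ i) ⊥ q (- p)
    module Two = Protagonist (λ s → ∃ λ i → s ≡ inj₂ i) ⊤ (- (K ℤ.* q)) (+ 2 ℤ.+ K ℤ.* p)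

    Two-load : ∀ vs → Two.load vs ≡ + 2 ℤ.* + length vs ℤ.- K ℤ.* One.load vs
    Two-load vs = identity q p K (levels vs) (+ length vs)
      where
      identity : ∀ q p K l n → - (K ℤ.* q) ℤ.* l ℤ.+ (+ 2 ℤ.+ K ℤ.* p) ℤ.* n ≡
                 + 2 ℤ.* n ℤ.- K ℤ.* (q ℤ.* l ℤ.+ - p ℤ.* n)
      identity = solve-∀

    -- A positive integer load is at least 1, and `K` exceeds twice the number of configurations of
    -- a cycle.
    One-positive⇒Two-nonpositive : ∀ vs → length vs ℕ.≤ size → 0ℤ ℤ.< One.load vs → Two.load vs ℤ.≤ 0ℤ
    One-positive⇒Two-nonpositive vs length≤size 0<load = begin
      Two.load vs                                      ≡⟨ Two-load vs ⟩
      + 2 ℤ.* + length vs ℤ.- K ℤ.* One.load vs        ≤⟨ ℤ.i≤j⇒i-j≤0 (begin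
        + 2 ℤ.* + length vs   ≡⟨ ℤ.pos-* 2 (length vs) ⟨
        + (2 ℕ.* length vs)   ≤⟨ ℤ.+≤+ (ℕ.≤-trans (ℕ.*-monoʳ-≤ 2 length≤size) (ℕ.n≤1+n penalty)) ⟩
        K                     ≡⟨ ℤ.*-identityʳ K ⟨
        K ℤ.* 1ℤ              ≤⟨ ℤ.*-monoˡ-≤-nonNeg K (ℤ.i<j⇒suc[i]≤j 0<load) ⟩
        K ℤ.* One.load vs     ∎) ⟩
      0ℤ                                               ∎
      where open ℤ.≤-Reasoning

    mutual
      -- The fuel bounds how many more configurations can join the simple path, whose length never
      -- exceeds `size`.
      determined : ∀ fuel s c vs → Unique ((s , c) ∷ vs) → All Valid ((s , c) ∷ vs) →
                   size ℕ.≤ length ((s , c) ∷ vs) ℕ.+ fuel →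
                   One.Win ((s , c) ∷ vs) ⊎ Two.Win ((s , c) ∷ vs)
      determined fuel (inj₁ i) c vs unique valid enough =
        Sum.map (uncurry (One.choose (i , refl))) Two.reply
          (∃⊎∀-Move λ m → judge fuel _ unique valid enough (next c m))
      determined fuel (inj₂ i) c vs unique valid enough =
        -- The roles are exchanged here: player 2 needs one good move, player 1 needs all of them to
        -- be good.
        Sum.swap (Sum.map (uncurry (Two.choose (i , refl))) One.reply
          (∃⊎∀-Move λ m → Sum.swap (judge fuel _ unique valid enough (next c m))))

      judge : ∀ fuel vs → Unique vs → All Valid vs → size ℕ.≤ length vs ℕ.+ fuel →
              ∀ v → One.After vs v ⊎ Two.After vs v
      judge fuel vs unique valid enough v with valid? v | v ∈? vs
      ... | no ¬valid | _ = inj₂ (Two.leave tt ¬valid)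
      ... | yes validᵛ | yes v∈vs
        with us , us′ , refl ← ∈-∃++ v∈vs
        with One.load (v ∷ us) ℤ.≤? 0ℤ
      ... | yes ≤0 = inj₁ (One.close validᵛ us us′ refl ≤0)
      ... | no ≰0  = inj₂ (Two.close validᵛ us us′ refl
        (One-positive⇒Two-nonpositive (v ∷ us) cycle≤size (ℤ.≰⇒> ≰0)))
        where
        cycle≤size : length (v ∷ us) ℕ.≤ size
        cycle≤size = begin
          suc (length us)                    ≤⟨ ℕ.+-monoʳ-≤ 1 (ℕ.m≤m+n (length us) (length us′)) ⟩
          suc (length us ℕ.+ length us′)     ≡⟨ ℕ.+-suc (length us) (length us′) ⟨
          length us ℕ.+ length (v ∷ us′)     ≡⟨ length-++ us ⟨
          length (us ++ v ∷ us′)             ≤⟨ Unique⇒length≤ code code-injective unique valid ⟩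
          size                               ∎
          where open ℕ.≤-Reasoning
      -- Without fuel the path already holds `size` configurations, so by pigeonhole none is new.
      judge zero vs unique valid enough v | yes validᵛ | no v∉vs = contradiction
        (Unique⇒length≤ code code-injective (¬Any⇒All¬ vs v∉vs ∷ unique) (validᵛ ∷ valid))
        (ℕ.<⇒≱ (s≤s (subst (size ℕ.≤_) (ℕ.+-identityʳ (length vs)) enough)))
      judge (suc fuel) vs unique valid enough v@(s , c) | yes validᵛ | no v∉vs =
        Sum.map (One.extend validᵛ (One.load≤bound unique′ valid′))
                (Two.extend validᵛ (Two.load≤bound unique′ valid′))
          (determined fuel s c vs unique′ valid′
            (subst (size ℕ.≤_) (ℕ.+-suc (length vs) fuel) enough))
        where
        unique′ = ¬Any⇒All¬ vs v∉vs ∷ unique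
        valid′ = validᵛ ∷ valid

-- Outcomes are consistent with the strategies that produce them.

module Outcomes (G : Game) where
  open Game G
  open Plays G

  -- Strategies are applied to `history` but objectives read `prefix`; this identifies the two
  -- paths.
  prefix-outcome : ∀ σ τ s n → prefix (outcome σ τ s) n ≡ proj₂ (history σ τ s n)
  prefix-outcome σ τ s zero    = refl
  prefix-outcome σ τ s (suc n) =
    cong (_▷ proj₂ (move σ τ (proj₂ (history σ τ s n)))) (prefix-outcome σ τ s n)

  module _ (act : ∀ {s} → Prefix s → ∃ (E s)) where

    outcome-follows₁ : ∀ τ s n → let π = outcome (λ _ → act) τ s in
      (∃ λ i → state π n ≡ inj₁ i) → (state π (suc n) , step π n) ≡ act (prefix π n)
    outcome-follows₁ τ s n mine =
      trans (move≡act (proj₂ (history _ τ s n)) mine) (cong act (sym (prefix-outcome _ τ s n)))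
      where
      -- Generalised over the path, because `move` computes only once the owner of the last state is
      -- matched.
      move≡act : ∀ {s} (ρ : Prefix s) → (∃ λ i → s ≡ inj₁ i) → move (λ _ → act) τ ρ ≡ act ρ
      move≡act ρ (_ , refl) = refl

    outcome-follows₂ : ∀ σ s n → let π = outcome σ (λ _ → act) s in
      (∃ λ i → state π n ≡ inj₂ i) → (state π (suc n) , step π n) ≡ act (prefix π n)
    outcome-follows₂ σ s n mine =
      trans (move≡act (proj₂ (history σ _ s n)) mine) (cong act (sym (prefix-outcome σ _ s n)))
      where
      move≡act : ∀ {s} (ρ : Prefix s) → (∃ λ i → s ≡ inj₂ i) → move σ (λ _ → act) ρ ≡ act ρ
      move≡act ρ (_ , refl) = refl

-- Deciding the problem with upper bound `U`.

module Solver (P : Problem) (U : ℕ) where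
  open Problem P
  open Game G using (S)
  open Arena G U
  open Determinacy (↧ t) (↥ t)
  open Outcomes G

  root-valid : All Valid ((sInit , 0ℤ) ∷ [])
  root-valid = (ℤ.≤-refl , ℤ.+≤+ z≤n) ∷ []

  energy : Play → ℕ → ℤ
  energy π n = sum₁ (λ i → EL (prefix π i)) n

  load-trace : ∀ α β π n →
    Weighted.load α β (trace (prefix π n)) ≡ α ℤ.* energy π n ℤ.+ β ℤ.* + suc n
  load-trace α β π n =
    cong₂ (λ l m → α ℤ.* l ℤ.+ β ℤ.* + m) (levels-trace π n) (length-trace π n)

  One-bounded⇒AvgEnergy : ∀ π → (∀ n → One.load (trace (prefix π n)) ℤ.≤ One.bound) → AvgEnergy t π
  One-bounded⇒AvgEnergy π bounded = bounded⇒limSup≤ (energy π) t One.bound λ n →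
    subst (ℤ._≤ One.bound) (load-trace (↧ t) (- ↥ t) π n) (bounded n)

  Two-bounded⇒¬AvgEnergy : ∀ π → (∀ n → Two.load (trace (prefix π n)) ℤ.≤ Two.bound) → ¬ AvgEnergy t π
  Two-bounded⇒¬AvgEnergy π bounded = bounded⇒¬limSup≤ (energy π) t penalty Two.bound λ n →
    subst (ℤ._≤ Two.bound) (load-trace (- (K ℤ.* ↧ t)) (+ 2 ℤ.+ K ℤ.* ↥ t) π n) (bounded n)


  One-wins : One.Win ((sInit , 0ℤ) ∷ []) → ∃ (WinsAELU U)
  One-wins win = (λ _ → act) , λ τ →
    let π = outcome (λ _ → act) τ sInit
        consistent = outcome-follows₁ act τ sInit
    in (λ n → subst (λ c → 0ℤ ℤ.≤ c × c ℤ.≤ + U) (sym (ℤ.+-identityˡ (EL (prefix π n))))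
               -- `Excused` is empty for player 1, so validity is a result of the play and not an
               -- assumption on it.
               (stays-valid π refl consistent (λ ()) n))
       , One-bounded⇒AvgEnergy π (stays-bounded π refl consistent (λ ()))
    where open One.FromRoot sInit win (One.load≤bound ([] ∷ []) root-valid)

  -- If `σ` won, its play against `act` would stay valid and never take a `leave` branch; the load
  -- bound of player 2 would then refute the average.
  Two-wins : Two.Win ((sInit , 0ℤ) ∷ []) → ¬ ∃ (WinsAELU U)
  Two-wins win (σ , wins) =
    let π = outcome σ (λ _ → act) sInit
        energyLU , avg = wins (λ _ → act)
        valid = λ _ n → subst (λ c → 0ℤ ℤ.≤ c × c ℤ.≤ + U) (ℤ.+-identityˡ (EL (prefix π n))) (energyLU n)
    in Two-bounded⇒¬AvgEnergy π (stays-bounded π refl (outcome-follows₂ act σ sInit) valid) avg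
    where open Two.FromRoot sInit win (Two.load≤bound ([] ∷ []) root-valid)

  decide : Dec (∃ (WinsAELU U))
  -- The initial path already has one configuration, so `size` is enough fuel.
  decide with determined size sInit 0ℤ [] ([] ∷ []) root-valid (ℕ.m≤n+m size 1)
  ... | inj₁ win = yes (One-wins win)
  ... | inj₂ win = no (Two-wins win)

-- Correctness of the incremental search.

module _ (solve : AELUSolver) (P : Problem) where
  open Problem P
  open Incremental solve P

  round-sound : ∀ U {V σ} → round U ≡ just (V , σ) → WinsAELU V σ
  round-sound U eq with solve P U
  round-sound U refl | yes (_ , wins) = wins

  -- The first success is kept through later rounds, so `V` is the bound of that round and may
  -- differ from `U`.
  search-sound : ∀ U {V σ} → search U ≡ just (V , σ) → WinsAELU V σ
  search-sound zero    eq = round-sound zero eq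
  search-sound (suc U) eq with search U in eqᵁ
  search-sound (suc U) refl | just _  = search-sound U eqᵁ
  search-sound (suc U) eq   | nothing = round-sound (suc U) eq

  round-complete : ∀ U → round U ≡ nothing → ¬ ∃ (WinsAELU U)
  round-complete U eq with solve P U
  round-complete U () | yes _
  round-complete U eq | no ¬wins = ¬wins

  -- The round at `U` itself is the one that a winning strategy never exceeding `U` would have made
  -- succeed.
  search-nothing⇒round-nothing : ∀ U → search U ≡ nothing → round U ≡ nothing
  search-nothing⇒round-nothing zero    eq = eq
  search-nothing⇒round-nothing (suc U) eq with search U
  search-nothing⇒round-nothing (suc U) () | just _
  search-nothing⇒round-nothing (suc U) eq | nothing = eq

open Problem
open Incremental

lemma11 : Σ[ solve ∈ AELUSolver ] ((P : Problem) →
    ((U V : ℕ) (σ : Strategy₁ P) →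
    search solve P U ≡ just (V , σ) → WinsAEL P σ)
    × ((U : ℕ) → search solve P U ≡ nothing →
    ¬ (Σ[ σ ∈ Strategy₁ P ]
    (WinsAEL P σ × Winning P (sInit P) (NeverExceeds P U) σ))))
lemma11 = Solver.decide , λ P →
  (λ U V σ found τ →
    let energyLU , avg = search-sound Solver.decide P U found τ
    in proj₁ ∘ energyLU , avg)
  , (λ U none (σ , wins , low) →
    -- Staying nonnegative and never exceeding `U` makes `σ` win the bounded problem, against the
    -- failure of that round.
    round-complete Solver.decide P U (search-nothing⇒round-nothing Solver.decide P U none)
      (σ , λ τ → let energyL , avg = wins τ in
        (λ n → energyL n , subst (ℤ._≤ + U) (sym (ℤ.+-identityˡ _)) (low τ n)) , avg))
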